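{- Let $G$ and $H$ be graphs and let $n\in\mathbb N$. Then $T_{G,n}\otimes T_{H,n}\equiv T_{G+H,n}$.
   Context: Graphs are finite, undirected, loopless and may have parallel edges. For graphs $G,H$ with disjoint edge sets (if necessary after replacing one edge set by a disjoint copy, keeping end-vertices), the sum $G+H$ has $V(G+H)=V(G)\cup V(H)$ and $E(G+H)=E(G)\cup E(H)$. Let $\mathbb F$ be a field. For a graph $G$ and $v\in V(G)$ let $I_G(v)$ be the set of edges incident to $v$, and let $X^{(v)}=\{x^{(v)}_g:g\colon I_G(v)\to[n]\}$ be a set of variables. The graph tensor is the tensor with modes $X^{(v)}$, $v\in V(G)$, given by $T_{G,n}=\sum_{f\colon E(G)\to[n]}\prod_{v\in V(G)}x^{(v)}_{f|_{I_G(v)}}$. A tensor is a polynomial over $\mathbb F$ in variables partitioned into modes such that each monomial contains exactly one variable of each mode, with degree one. The Kronecker product of $T_{G,n}$ and $T_{H,n}$ is the polynomial product (with disjoint sets of variables) whose modes, indexed by $v\in V(G)\cup V(H)$, are the Cartesian products of the $v$-modes of the two factors (a product of two variables of the same mode index is regarded as one variable of the product mode); if $v$ is a vertex of only one of the graphs, one sets the set of incident edges in the other graph to be $\emptyset$, so that its $v$-mode there has a single variable (indexed by the empty function). $S\equiv T$ (equivalence) means that $S$ is obtained from $T$ by a bijective renaming of variables that also induces a bijection of modes. -}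

module Defs where

open import Algebra.Apartness.Bundles using (HeytingField)
open import Data.Fin.Base using (Fin; finToFun)
open import Data.Fin.Subset using (Subset; _∈_; _⊆_; _∪_; ∣_∣)
open import Data.Fin.Subset.Properties using (_∈?_; p⊆p∪q; q⊆p∪q)
open import Data.List.Base using (List; []; _∷_; map; cartesianProductWith; tabulate)
open import Data.Nat.Base using (ℕ; _+_; _^_)
open import Data.Product.Base using (∃; _×_; _,_; proj₁; map₂)
open import Data.Product.Relation.Binary.Pointwise.NonDependent using (×-setoid)
open import Data.Unit.Base using (tt)
import Data.Unit.Properties as Unit
open import Data.Vec.Functional using (Vector; _++_)
open import Data.Vec.Functional.Relation.Unary.All.Properties using (++⁺)
open import Function.Base using (_∘_)
open import Function.Bundles using (Inverse; _↔_)
open import Level using (Level; 0ℓ; suc; _⊔_)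
open import Relation.Binary.Bundles using (Setoid)
open import Relation.Binary.PropositionalEquality using (_≡_; _→-setoid_)
open import Relation.Nullary.Decidable.Core using (yes; no)

-- All graphs draw their vertices from a common finite supply Fin N, so that two
-- graphs may share some, all or none of their vertices.  An edge is known only
-- through its two-element set of end-vertices: this makes graphs undirected and
-- loopless, and since `ends` need not be injective, parallel edges are allowed.
record Graph (N : ℕ) : Set where
  field
    vertices : Subset N
    size     : ℕ
    ends     : Vector (Subset N) size
    ends⊆    : ∀ e → ends e ⊆ vertices
    twoEnds  : ∀ e → ∣ ends e ∣ ≡ 2

open Graph public

infixl 6 _+ᴳ_

-- Concatenating the edge families makes the two edge sets disjoint.
_+ᴳ_ : ∀ {N} → Graph N → Graph N → Graph N
G +ᴳ H = record
  { vertices = vertices G ∪ vertices H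
  ; size     = size G + size H
  ; ends     = ends G ++ ends H
  ; ends⊆    = ++⁺ (_⊆ (vertices G ∪ vertices H)) {xs = ends G} {ys = ends H}
                 (λ e → p⊆p∪q (vertices H) ∘ ends⊆ G e)
                 (λ e → q⊆p∪q (vertices G) (vertices H) ∘ ends⊆ H e)
  ; twoEnds  = ++⁺ (λ p → ∣ p ∣ ≡ 2) {xs = ends G} {ys = ends H}
                 (twoEnds G) (twoEnds H)
  }

Elem : ∀ {N} → Subset N → Set
Elem p = ∃ (_∈ p)

Incident : ∀ {N} → Graph N → Fin N → Set
Incident G v = ∃ λ e → v ∈ ends G e

-- A family of modes; the setoid X i is the set of variables of mode i.
Modes : Set → Set₁
Modes I = I → Setoid 0ℓ 0ℓ

-- A monomial with exactly one variable of each mode, to degree one, is a choice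
-- of a variable in every mode.
Monomial : ∀ {I} → Modes I → Set
Monomial X = ∀ i → Setoid.Carrier (X i)

-- The modes of a tensor with mode set p, extended to every v by a
-- single-variable mode when v ∉ p.
padModes : ∀ {N} {p : Subset N} → Modes (Elem p) → Modes (Fin N)
padModes {p = p} X v with v ∈? p
... | yes v∈p = X (v , v∈p)
... | no  _   = Unit.≡-setoid

pad : ∀ {N} {p : Subset N} (X : Modes (Elem p)) → Monomial X → Monomial (padModes X)
pad {p = p} X a v with v ∈? p
... | yes v∈p = a (v , v∈p)
... | no  _   = tt

infixr 7 _⊗ᵐ_

_⊗ᵐ_ : ∀ {N} {p q : Subset N} → Modes (Elem p) → Modes (Elem q) → Modes (Elem (p ∪ q))
(X ⊗ᵐ Y) (v , _) = ×-setoid (padModes X v) (padModes Y v)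

-- `modes` and `vars` together are a bijection from the variables of X to those
-- of Y carrying modes onto modes.
record Renaming {I J : Set} (X : Modes I) (Y : Modes J) : Set where
  field
    modes : J ↔ I
    vars  : ∀ j → Inverse (X (Inverse.to modes j)) (Y j)

  rename : Monomial X → Monomial Y
  rename a j = Inverse.to (vars j) (a (Inverse.to modes j))

module Tensors {c ℓ₁ ℓ₂ : Level} (F : HeytingField c ℓ₁ ℓ₂) where

  private module F = HeytingField F

  -- A polynomial is a formal sum of terms (coefficient , monomial).
  Poly : ∀ {I} → Modes I → Set c
  Poly X = List (F.Carrier × Monomial X)

  infix 4 _⊢_≋_

  -- Equality of polynomials: the congruence presenting the F-vector space with
  -- basis the monomials (up to equality of their variables).
  data _⊢_≋_ {I : Set} (X : Modes I) : Poly X → Poly X → Set (c ⊔ ℓ₁) where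
    []      : X ⊢ [] ≋ []
    cons    : ∀ {r s a b P Q} → r F.≈ s → (∀ i → Setoid._≈_ (X i) (a i) (b i)) →
              X ⊢ P ≋ Q → X ⊢ (r , a) ∷ P ≋ (s , b) ∷ Q
    swap    : ∀ {t u P} → X ⊢ t ∷ u ∷ P ≋ u ∷ t ∷ P
    collect : ∀ {r s a P} → X ⊢ (r , a) ∷ (s , a) ∷ P ≋ (r F.+ s , a) ∷ P
    drop    : ∀ {a P} → X ⊢ (F.0# , a) ∷ P ≋ P
    sym     : ∀ {P Q} → X ⊢ P ≋ Q → X ⊢ Q ≋ P
    trans   : ∀ {P Q R} → X ⊢ P ≋ Q → X ⊢ Q ≋ R → X ⊢ P ≋ R

  record Tensor (I : Set) : Set (suc 0ℓ ⊔ c) where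
    constructor tensor
    field
      modes : Modes I
      poly  : Poly modes

  open Tensor public

  infixr 7 _⊗_

  -- The product of the two polynomials, where the variables x, y of mode v in
  -- the factors are merged into the single variable (x , y).
  _⊗_ : ∀ {N} {p q : Subset N} → Tensor (Elem p) → Tensor (Elem q) → Tensor (Elem (p ∪ q))
  tensor X P ⊗ tensor Y Q = tensor (X ⊗ᵐ Y)
    (cartesianProductWith
      (λ (r , a) (s , b) → r F.* s , λ (v , _) → pad X a v , pad Y b v)
      P Q)

  infix 4 _≡ᵀ_

  _≡ᵀ_ : ∀ {I J} → Tensor I → Tensor J → Set (c ⊔ ℓ₁)
  S ≡ᵀ T = ∃ λ (ρ : Renaming (modes S) (modes T)) →
    modes T ⊢ map (map₂ (Renaming.rename ρ)) (poly S) ≋ poly T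

  -- The variables of mode v are the functions g : I_G(v) → [n] (compared
  -- pointwise), and finToFun enumerates the n ^ size G functions f : E(G) → [n].
  graphTensor : ∀ {N} (G : Graph N) → ℕ → Tensor (Elem (vertices G))
  graphTensor G n = tensor
    (λ (v , _) → Incident G v →-setoid Fin n)
    (tabulate {n = n ^ size G} λ k → F.1# , λ _ → finToFun k ∘ proj₁)

{-# OPTIONS --safe #-}

-- Pulling apart the edges at v, a variable of T_{G+H,n} of mode v is the same thing
-- as a pair of variables of mode v of T_{G,n} and T_{H,n} (for v outside one of the
-- graphs, the functions on its empty set of edges form the single-variable mode).
-- Under this renaming the terms of the product, enumerated lexicographically, are
-- literally the terms of T_{G+H,n} in their own enumeration order: a pair of edge
-- colourings, coded by the base-n numerals i and j, is the edge colouring of G + H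
-- coded by i followed by j.
module Submission where

open import Defs
open import Algebra.Apartness.Bundles using (HeytingField)
open import Data.Fin.Base using (Fin; zero; suc; toℕ; splitAt; join; combine; remQuot; cast; finToFun; _↑ˡ_; _↑ʳ_)
open import Data.Fin.Properties using (toℕ-injective; toℕ-combine; toℕ-cast; toℕ-↑ˡ; join-splitAt; remQuot-combine; combine-remQuot; splitAt-↑ˡ; splitAt-↑ʳ)
open import Data.Fin.Subset using (_∈_)
open import Data.Fin.Subset.Properties using (_∈?_)
open import Data.List.Base as List using (map; tabulate; cartesianProductWith)
open import Data.List.Properties using (tabulate-cong; map-tabulate)
open import Data.Nat.Base using (ℕ; _+_; _*_; _^_)
open import Data.Nat.Properties using (^-distribˡ-+-*)
open import Data.Nat.Tactic.RingSolver using (solve-∀)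
open import Data.Product.Base using (_×_; _,_; proj₁; proj₂; map₁; map₂; uncurry)
open import Data.Product.Function.NonDependent.Setoid using (_×-inverse_)
open import Data.Product.Relation.Binary.Pointwise.NonDependent using (×-setoid)
open import Data.Sum.Base as Sum using (_⊎_; inj₁; inj₂; [_,_]′)
open import Data.Unit.Base using (tt)
open import Data.Vec.Functional using (Vector; _++_)
open import Data.Vec.Functional.Properties using (lookup-++ˡ; lookup-++ʳ)
open import Data.Vec.Properties.WithK using ([]=-irrelevant)
open import Function.Base using (_∘_)
open import Function.Bundles using (Inverse; _↔_; mk↔ₛ′)
import Function.Construct.Composition as Composition
import Function.Construct.Identity as Identity
open import Relation.Binary.Bundles using (Setoid)
open import Relation.Binary.PropositionalEquality using (_≡_; _≗_; _→-setoid_; refl; sym; trans; cong; cong₂; subst; module ≡-Reasoning)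
open import Relation.Nullary.Decidable.Core using (yes; no)
open import Relation.Nullary.Negation.Core using (contradiction)

open ≡-Reasoning

tabulate-splitAt : ∀ {a} {A : Set a} m {n} (f : Fin (m + n) → A) →
  tabulate f ≡ tabulate (f ∘ (_↑ˡ n)) List.++ tabulate (f ∘ (m ↑ʳ_))
tabulate-splitAt ℕ.zero    f = refl
tabulate-splitAt (ℕ.suc m) f = cong (_ List.∷_) (tabulate-splitAt m (f ∘ suc))

-- The list product varies its second index fastest, which is the order in which `remQuot` reads a
-- position as quotient and remainder. In the induction on `m`, the first `n` positions have
-- quotient `zero`, and a shift by `n` raises the quotient by one.
cartesianProductWith-tabulate : ∀ {a b c} {A : Set a} {B : Set b} {C : Set c}
  (f : A → B → C) {m n} (g : Fin m → A) (h : Fin n → B) →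
  cartesianProductWith f (tabulate g) (tabulate h) ≡
  tabulate (uncurry (λ i j → f (g i) (h j)) ∘ remQuot {m} n)
cartesianProductWith-tabulate f {ℕ.zero}      g h = refl
cartesianProductWith-tabulate f {ℕ.suc m} {n} g h = begin
  map (f (g zero)) (tabulate h) List.++ cartesianProductWith f (tabulate (g ∘ suc)) (tabulate h)
    ≡⟨ cong₂ List._++_ (map-tabulate h (f (g zero))) (cartesianProductWith-tabulate f (g ∘ suc) h) ⟩
  tabulate (f (g zero) ∘ h) List.++ tabulate (uncurry (λ i j → f (g (suc i)) (h j)) ∘ remQuot {m} n)
    ≡⟨ cong₂ List._++_
         (tabulate-cong λ j → sym (cong k (remQuot-combine {ℕ.suc m} zero j)))
         (tabulate-cong remQuot-↑ʳ) ⟩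
  tabulate (k ∘ remQuot {ℕ.suc m} n ∘ (_↑ˡ m * n)) List.++ tabulate (k ∘ remQuot {ℕ.suc m} n ∘ (n ↑ʳ_))
    ≡⟨ tabulate-splitAt n (k ∘ remQuot {ℕ.suc m} n) ⟨
  tabulate (k ∘ remQuot {ℕ.suc m} n) ∎
  where
  k = uncurry (λ i j → f (g i) (h j))

  remQuot-↑ʳ : ∀ i → k (map₁ suc (remQuot {m} n i)) ≡ k (remQuot {ℕ.suc m} n (n ↑ʳ i))
  remQuot-↑ʳ i rewrite splitAt-↑ʳ n (m * n) i = refl

-- Both sides are the mixed-radix numeral with digits `i`, `j`, `k`, so their values in ℕ agree. The
-- bound `o` is separate from `m * n` so that it can be `n ^ (a + b)`, equal to `n ^ a * n ^ b` only
-- propositionally.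
combine-assoc : ∀ {l m n o} (i : Fin l) (j : Fin m) (k : Fin n)
  (eq : m * n ≡ o) .(eq′ : l * m * n ≡ l * o) →
  cast eq′ (combine (combine i j) k) ≡ combine i (cast eq (combine j k))
combine-assoc {l} {m} {n} {o} i j k eq eq′ = toℕ-injective (begin
  toℕ (cast eq′ (combine (combine i j) k))   ≡⟨ toℕ-cast eq′ _ ⟩
  toℕ (combine (combine i j) k)              ≡⟨ toℕ-combine (combine i j) k ⟩
  n * toℕ (combine i j) + toℕ k              ≡⟨ cong (λ x → n * x + toℕ k) (toℕ-combine i j) ⟩
  n * (m * toℕ i + toℕ j) + toℕ k            ≡⟨ regroup m n (toℕ i) (toℕ j) (toℕ k) ⟩
  m * n * toℕ i + (n * toℕ j + toℕ k)        ≡⟨ cong₂ (λ x y → x * toℕ i + y) eq (sym (toℕ-combine j k)) ⟩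
  o * toℕ i + toℕ (combine j k)              ≡⟨ cong (o * toℕ i +_) (toℕ-cast eq _) ⟨
  o * toℕ i + toℕ (cast eq (combine j k))    ≡⟨ toℕ-combine i _ ⟨
  toℕ (combine i (cast eq (combine j k)))    ∎)
  where
  regroup : ∀ m n x y z → n * (m * x + y) + z ≡ m * n * x + (n * y + z)
  regroup = solve-∀

-- `finToFun` lists base-`n` digits from the most significant one, so writing one numeral after
-- another concatenates their digit strings. The induction peels off the leading digit of `i`.
finToFun-combine : ∀ {n} a {b} (i : Fin (n ^ a)) (j : Fin (n ^ b))
  (eq : n ^ a * n ^ b ≡ n ^ (a + b)) →
  finToFun {n} {a + b} (cast eq (combine i j)) ≗ finToFun {n} {a} i ++ finToFun {n} {b} j
-- Here `i` lies in `Fin 1`, and `combine zero j` is `j ↑ˡ 0`, which has the value of `j`.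
finToFun-combine {n} ℕ.zero {b} zero j eq e =
  cong (λ k → finToFun {n} {b} k e)
    (toℕ-injective (trans (toℕ-cast eq (j ↑ˡ 0)) (toℕ-↑ˡ j 0)))
finToFun-combine {n} (ℕ.suc a) {b} i j eq
  with remQuot {n} (n ^ a) i in rq
... | i₀ , i′ = go
  where
  eq′ = sym (^-distribˡ-+-* n a b)

  -- With `i` written as the digit `i₀` followed by `i′`, associativity brings `i₀` to the front,
  -- where `remQuot` reads it off.
  split : remQuot {n} (n ^ (a + b)) (cast eq (combine i j)) ≡ (i₀ , cast eq′ (combine i′ j))
  split = begin
    remQuot (n ^ (a + b)) (cast eq (combine i j))
      ≡⟨ cong (λ k → remQuot {n} (n ^ (a + b)) (cast eq (combine k j)))
           (trans (sym (combine-remQuot {n} (n ^ a) i)) (cong (uncurry combine) rq)) ⟩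
    remQuot (n ^ (a + b)) (cast eq (combine (combine i₀ i′) j))
      ≡⟨ cong (remQuot (n ^ (a + b))) (combine-assoc i₀ i′ j eq′ eq) ⟩
    remQuot (n ^ (a + b)) (combine i₀ (cast eq′ (combine i′ j)))
      ≡⟨ remQuot-combine i₀ _ ⟩
    (i₀ , cast eq′ (combine i′ j)) ∎

  go : finToFun {n} {ℕ.suc a + b} (cast eq (combine i j)) ≗
       finToFun {n} {ℕ.suc a} i ++ finToFun {n} {b} j
  go zero    = trans (cong proj₁ split) (sym (cong proj₁ rq))
  go (suc e) = begin
    finToFun {n} {a + b} (proj₂ (remQuot {n} (n ^ (a + b)) (cast eq (combine i j)))) e
      ≡⟨ cong (λ p → finToFun {n} {a + b} (proj₂ p) e) split ⟩
    finToFun {n} {a + b} (cast eq′ (combine i′ j)) e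
      ≡⟨ finToFun-combine a {b} i′ j eq′ e ⟩
    (finToFun {n} {a} i′ ++ finToFun {n} {b} j) e
      ≡⟨ shift ⟩
    (finToFun {n} {ℕ.suc a} i ++ finToFun {n} {b} j) (suc e) ∎
    where
    shift : (finToFun {n} {a} i′ ++ finToFun {n} {b} j) e ≡
            (finToFun {n} {ℕ.suc a} i ++ finToFun {n} {b} j) (suc e)
    -- `splitAt (suc a) (suc e)` computes from `splitAt a e`, so this one case distinction reduces
    -- both sides.
    shift with splitAt a e
    ... | inj₁ e′ = sym (cong (λ p → finToFun {n} {a} (proj₂ p) e′) rq)
    ... | inj₂ _  = refl

module _ {N} (G H : Graph N) (v : Fin N) where

  splitIncident : Incident (G +ᴳ H) v → Incident G v ⊎ Incident H v
  splitIncident (e , v∈e) with splitAt (size G) e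
  ... | inj₁ e′ = inj₁ (e′ , v∈e)
  ... | inj₂ e′ = inj₂ (e′ , v∈e)

  joinIncident : Incident G v ⊎ Incident H v → Incident (G +ᴳ H) v
  joinIncident (inj₁ (e , v∈e)) =
    e ↑ˡ size H , subst (v ∈_) (sym (lookup-++ˡ (ends G) (ends H) e)) v∈e
  joinIncident (inj₂ (e , v∈e)) =
    size G ↑ʳ e , subst (v ∈_) (sym (lookup-++ʳ (ends G) (ends H) e)) v∈e

  -- Links the renaming of variables to the concatenation of colourings. `g` and `h` are only
  -- pointwise restrictions of `x` and `y`, because that is what is known of padded variables.
  splitIncident-++ : ∀ {a} {A : Set a} {g : Incident G v → A} {h : Incident H v → A}
    (x : Vector A (size G)) (y : Vector A (size H)) → g ≗ x ∘ proj₁ → h ≗ y ∘ proj₁ →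
    [ g , h ]′ ∘ splitIncident ≗ (x ++ y) ∘ proj₁
  splitIncident-++ x y g≗ h≗ (e , v∈e) with splitAt (size G) e
  ... | inj₁ e′ = g≗ (e′ , v∈e)
  ... | inj₂ e′ = h≗ (e′ , v∈e)

-- Membership in a subset has at most one proof.
Incident-≡ : ∀ {N} (G : Graph N) {v} {ι κ : Incident G v} → proj₁ ι ≡ proj₁ κ → ι ≡ κ
Incident-≡ G {ι = e , _} refl = cong (e ,_) ([]=-irrelevant _ _)

Incident-+ᴳ : ∀ {N} (G H : Graph N) v → Incident (G +ᴳ H) v ↔ (Incident G v ⊎ Incident H v)
Incident-+ᴳ G H v = mk↔ₛ′ (splitIncident G H v) (joinIncident G H v) split-join join-split
  where
  split-join : ∀ ι → splitIncident G H v (joinIncident G H v ι) ≡ ι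
  split-join (inj₁ (e , v∈e))
    -- The transported proof is made a variable first, so that the rewriting of `splitAt` can also
    -- change its type.
    with subst (v ∈_) (sym (lookup-++ˡ (ends G) (ends H) e)) v∈e
  ... | v∈e′ rewrite splitAt-↑ˡ (size G) e (size H) = cong inj₁ (Incident-≡ G refl)
  split-join (inj₂ (e , v∈e))
    with subst (v ∈_) (sym (lookup-++ʳ (ends G) (ends H) e)) v∈e
  ... | v∈e′ rewrite splitAt-↑ʳ (size G) (size H) e = cong inj₂ (Incident-≡ H refl)

  proj₁-split : ∀ ι → Sum.map proj₁ proj₁ (splitIncident G H v ι) ≡ splitAt (size G) (proj₁ ι)
  proj₁-split (e , v∈e) with splitAt (size G) e
  ... | inj₁ _ = refl
  ... | inj₂ _ = refl

  proj₁-join : ∀ ι → proj₁ (joinIncident G H v ι) ≡ join (size G) (size H) (Sum.map proj₁ proj₁ ι)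
  proj₁-join (inj₁ _) = refl
  proj₁-join (inj₂ _) = refl

  join-split : ∀ ι → joinIncident G H v (splitIncident G H v ι) ≡ ι
  -- It suffices to compare edges, for which the law is that `join` undoes `splitAt`.
  join-split ι@(e , _) = Incident-≡ (G +ᴳ H) (begin
    proj₁ (joinIncident G H v (splitIncident G H v ι))
      ≡⟨ proj₁-join (splitIncident G H v ι) ⟩
    join (size G) (size H) (Sum.map proj₁ proj₁ (splitIncident G H v ι))
      ≡⟨ cong (join (size G) (size H)) (proj₁-split ι) ⟩
    join (size G) (size H) (splitAt (size G) e)
      ≡⟨ join-splitAt (size G) (size H) e ⟩
    e ∎)

edgeModes : ∀ {N} (G : Graph N) → ℕ → Modes (Elem (vertices G))
edgeModes G n (v , _) = Incident G v →-setoid Fin n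

-- A vertex outside `G` has no incident edge, because `ends⊆`; the functions on the empty set then
-- form a one-element mode like the padding. Later arguments thus treat all vertices alike.
padded↔ : ∀ {N} (G : Graph N) n v →
  Inverse (padModes (edgeModes G n) v) (Incident G v →-setoid Fin n)
padded↔ G n v with v ∈? vertices G
... | yes _   = Identity.inverse _
... | no  v∉G = record
  { to        = λ _ ι → absurd ι
  ; from      = λ _ → tt
  ; to-cong   = λ _ _ → refl
  ; from-cong = λ _ → refl
  ; inverse   = (λ _ ι → absurd ι) , λ _ → refl
  }
  where
  absurd : ∀ {a} {A : Set a} → Incident G v → A
  absurd (e , v∈e) = contradiction (ends⊆ G e v∈e) v∉G

padded↔-pad : ∀ {N} (G : Graph N) n v (f : Fin (size G) → Fin n) (ι : Incident G v) →
  Inverse.to (padded↔ G n v) (pad {p = vertices G} (edgeModes G n) (λ _ → f ∘ proj₁) v) ι ≡ f (proj₁ ι)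
padded↔-pad G n v f (e , v∈e) with v ∈? vertices G
... | yes _   = refl
... | no  v∉G = contradiction (ends⊆ G e v∈e) v∉G

-- The exponential law `C^(A + B) = C^A × C^B`, transported along the given bijection.
→-setoid-⊎ : ∀ {a b c d} {A : Set a} {B : Set b} {C : Set c} {D : Set d} → D ↔ (A ⊎ B) →
  Inverse (×-setoid (A →-setoid C) (B →-setoid C)) (D →-setoid C)
→-setoid-⊎ {A = A} {B} {C} D↔A⊎B = record
  { to        = λ (g , h) → [ g , h ]′ ∘ to
  ; from      = λ f → f ∘ from ∘ inj₁ , f ∘ from ∘ inj₂
  ; to-cong   = λ {_} {(g , h)} (g≗ , h≗) → [,]-≗ {k = [ g , h ]′} g≗ h≗ ∘ to
  ; from-cong = λ f≗ → f≗ ∘ from ∘ inj₁ , f≗ ∘ from ∘ inj₂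
  ; inverse   = (λ {f} (g≗ , h≗) ι → trans ([,]-≗ {k = f ∘ from} g≗ h≗ (to ι)) (cong f (strictlyInverseʳ ι)))
              , (λ {(g , h)} f≗ → (λ a → trans (f≗ _) (cong [ g , h ]′ (strictlyInverseˡ (inj₁ a))))
                                , (λ b → trans (f≗ _) (cong [ g , h ]′ (strictlyInverseˡ (inj₂ b)))))
  }
  where
  open Inverse D↔A⊎B using (to; from; strictlyInverseˡ; strictlyInverseʳ)

  [,]-≗ : {g : A → C} {h : B → C} {k : A ⊎ B → C} → g ≗ k ∘ inj₁ → h ≗ k ∘ inj₂ → [ g , h ]′ ≗ k
  [,]-≗ g≗ h≗ (inj₁ a) = g≗ a
  [,]-≗ g≗ h≗ (inj₂ b) = h≗ b

module _ {c ℓ₁ ℓ₂} (F : HeytingField c ℓ₁ ℓ₂) where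
  open Tensors F
  private module F = HeytingField F

  -- The lengths may be equal only propositionally, as `n ^ a * n ^ b` and `n ^ (a + b)` are; hence
  -- the `cast`.
  tabulate-≋ : ∀ {I} {X : Modes I} {m n} (m≡n : m ≡ n)
    {t : Fin m → F.Carrier × Monomial X} {u : Fin n → F.Carrier × Monomial X} →
    (∀ k → proj₁ (t k) F.≈ proj₁ (u (cast m≡n k))) →
    (∀ k i → Setoid._≈_ (X i) (proj₂ (t k) i) (proj₂ (u (cast m≡n k)) i)) →
    X ⊢ tabulate t ≋ tabulate u
  tabulate-≋ {m = ℕ.zero}  refl r≈s a≈b = []
  tabulate-≋ {m = ℕ.suc _} refl r≈s a≈b =
    cons (r≈s zero) (a≈b zero) (tabulate-≋ refl (r≈s ∘ suc) (a≈b ∘ suc))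

lemma12 : ∀ {c ℓ₁ ℓ₂} (F : HeytingField c ℓ₁ ℓ₂) {N : ℕ} (G H : Graph N) (n : ℕ) →
    let open Tensors F in
    graphTensor G n ⊗ graphTensor H n ≡ᵀ graphTensor (G +ᴳ H) n
lemma12 F G H n = ρ , subst (edgeModes (G +ᴳ H) n ⊢_≋ poly (graphTensor (G +ᴳ H) n)) (sym terms)
  -- Both lists are in the same order, so terms are compared position by position; the coefficients
  -- agree by `1# * 1# = 1#`.
  (tabulate-≋ F eq {u = λ k → F.1# , colouring (G +ᴳ H) k} (λ _ → F.*-identityˡ F.1#) monomials)
  where
  open Tensors F using (_⊢_≋_; poly; graphTensor)
  module F = HeytingField F

  a = size G
  b = size H
  eq = sym (^-distribˡ-+-* n a b)
  X = edgeModes G n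
  Y = edgeModes H n

  ρ : Renaming (X ⊗ᵐ Y) (edgeModes (G +ᴳ H) n)
  ρ = record
    -- The vertex set of `G +ᴳ H` is by definition the union that indexes the product modes.
    { modes = Identity.↔-id _
    ; vars  = λ (v , _) → Composition.inverse
                (padded↔ G n v ×-inverse padded↔ H n v) (→-setoid-⊎ (Incident-+ᴳ G H v))
    }

  open Renaming ρ using (rename)

  colouring : (G : Graph _) → Fin (n ^ size G) → Monomial (edgeModes G n)
  colouring G i _ = finToFun i ∘ proj₁

  product : F.Carrier × Monomial X → F.Carrier × Monomial Y → F.Carrier × Monomial (X ⊗ᵐ Y)
  product (r , x) (s , y) = r F.* s , λ (v , _) → pad X x v , pad Y y v

  productTerm : Fin (n ^ a) → Fin (n ^ b) → F.Carrier × Monomial (X ⊗ᵐ Y)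
  productTerm i j = product (F.1# , colouring G i) (F.1# , colouring H j)

  terms : map (map₂ rename) (cartesianProductWith product
            (tabulate λ i → F.1# , colouring G i) (tabulate λ j → F.1# , colouring H j)) ≡
          tabulate (map₂ rename ∘ uncurry productTerm ∘ remQuot {n ^ a} (n ^ b))
  terms = trans
    (cong (map (map₂ rename)) (cartesianProductWith-tabulate product {n ^ a} {n ^ b} _ _))
    (map-tabulate _ (map₂ rename))

  monomial : ∀ i j v ι →
    rename (proj₂ (productTerm i j)) v ι ≡
    finToFun {n} {a + b} (cast eq (combine i j)) (proj₁ ι)
  monomial i j (v , _) ι = trans
    (splitIncident-++ G H v (finToFun {n} {a} i) (finToFun {n} {b} j)
      (padded↔-pad G n v (finToFun i)) (padded↔-pad H n v (finToFun j)) ι)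
    (sym (finToFun-combine a {b} i j eq (proj₁ ι)))

  monomials : ∀ k v ι →
    rename (proj₂ (uncurry productTerm (remQuot {n ^ a} (n ^ b) k))) v ι ≡
    finToFun {n} {a + b} (cast eq k) (proj₁ ι)
  -- Every position `k` is the `combine` of its quotient and remainder, which reduces the claim to
  -- `monomial`.
  monomials k v ι = trans
    (uncurry monomial (remQuot {n ^ a} (n ^ b) k) v ι)
    (cong (λ k → finToFun {n} {a + b} (cast eq k) (proj₁ ι))
      (combine-remQuot {n ^ a} (n ^ b) k))
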